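{- Let $G=(V,E)$ be a finite DAG, let $\mathcal{H}_G\subseteq\mathbb{R}^E$ be the set of non-generic weight matrices supported on $G$, and let $C\in\mathbb{R}^E\setminus\mathcal{H}_G$ be generic. The set $$\operatorname{cone}_G(C):=\{C'\in\mathbb{R}^E\setminus\mathcal{H}_G:\mathcal{M}_*(G,C)=\mathcal{M}_*(G,C')\}$$ is a full-dimensional open polyhedral cone, defined by the linear inequalities (in $C'\in\mathbb{R}^E$) $$\omega_{C'}\big(\pi^{ij}_{\mathrm{crit}}(G,C)\big)>\omega_{C'}(\pi)\quad\text{for each }\pi\in P(i,j)\setminus\{\pi^{ij}_{\mathrm{crit}}(G,C)\},$$ for all distinct $i,j\in V$ (with $P(i,j)\neq\emptyset$).
   Context: Let $G=(V,E)$ be a finite DAG. $\mathbb{R}^E$ denotes the set of weight matrices supported on $G$: $V\times V$ matrices $C=(c_{ij})$ with $c_{ij}\in\mathbb{R}$ if $i\to j\in E$ and $c_{ij}=-\infty$ otherwise (identified with the Euclidean space indexed by $E$). For distinct $i,j\in V$, $P(i,j)$ is the set of directed paths from $i$ to $j$ in $G$, and the weight of a path $\pi$ is $\omega_C(\pi)=\sum_{e\in\pi}c_e$. A path in $P(i,j)$ is critical (for $(G,C)$) if its weight is maximal among all paths in $P(i,j)$. $C$ is generic if for all distinct $i,j$ with $P(i,j)\ne\emptyset$ there is exactly one critical path from $i$ to $j$; it is then denoted $\pi^{ij}_{\mathrm{crit}}(G,C)$. For $L\subseteq V$, the critical DAG $G^*_{C,L}$ is the DAG on $V$ with an edge $i\to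 j$ ($i\neq j$) if and only if $P(i,j)\neq\emptyset$ and no critical path from $i$ to $j$ in $(G,C)$ has an interior node in $L$. Distinct $i,j\in V\setminus L$ are $C^*$-connected given $L$ if $G^*_{C,L}$ contains, up to exchanging $i$ and $j$, a path of one of the forms (a) $i\to j$; (b) $i\leftarrow p\to j$; (c) $i\to \ell\leftarrow j$; (d) $i\leftarrow p\to\ell\leftarrow j$; (e) $i\leftarrow p\to\ell\leftarrow q\to j$, with $\ell\in L$ and $p,q\notin L$. Otherwise they are $C^*$-separated given $L$. For pairwise disjoint $I,J,L\subseteq V$, $I$ and $J$ are $C^*$-separated given $L$ if every $i\in I$ and $j\in J$ are $C^*$-separated given $L$. The maxoid $\mathcal{M}_*(G,C)$ is the set of all triples (CI statements) $[I\perp\!\!\!\perp J\mid L]$ with $I,J,L$ pairwise disjoint such that $I$ and $J$ are $C^*$-separated given $L$ in $(G,C)$. An open polyhedral cone is a finite intersection of open linear half-spaces (possibly the whole space). -}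

module Defs where

open import Level using (0ℓ)
open import Data.Bool.Base using (Bool; true; false; T)
open import Data.Fin.Base using (Fin)
open import Data.Fin.Subset using (Subset; _∈_; _∉_; _∩_; Empty)
open import Data.List.Base using (List; []; _∷_)
open import Data.List.Relation.Unary.All using (All)
import Data.List.Membership.Propositional as List
open import Data.Nat.Base as ℕ using (ℕ)
import Data.Nat.Properties as ℕ
open import Data.Product
  using (_×_; _,_; proj₁; ∃; ∃₂; ∃!; ∃-syntax; Σ-syntax)
open import Data.Rational.Base as ℚ using (ℚ; 0ℚ; 1ℚ; ∣_∣)
import Data.Rational.Properties as ℚ
open import Data.Rational.Solver using (module +-*-Solver)
open import Data.Sum.Base using (_⊎_)
open import Data.Unit.Base using (tt)
open import Algebra.Bundles.Raw using (RawMonoid)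
import Algebra.Definitions.RawMonoid as RawMonoidDefs
open import Relation.Binary.Construct.Closure.ReflexiveTransitive
  using (Star; ε; _◅_)
open import Relation.Binary.Construct.Closure.Transitive using (TransClosure)
open import Relation.Binary.PropositionalEquality
  using (_≡_; _≢_; refl; sym; trans; cong; cong₂; subst)
open import Relation.Nullary using (¬_)
open import Relation.Unary using (Pred; _≐_)

------------------------------------------------------------------------
-- Real numbers: Cauchy sequences of rationals, with arithmetic defined
-- pointwise.  Equality of reals is the relation _≈_ (the difference is
-- a null sequence).

IsCauchy : (ℕ → ℚ) → Set
IsCauchy x = ∀ δ → 0ℚ ℚ.< δ →
  ∃[ N ] (∀ m n → N ℕ.≤ m → N ℕ.≤ n → ∣ x m ℚ.- x n ∣ ℚ.< δ)

record ℝ : Set where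
  constructor mkℝ
  field
    seq    : ℕ → ℚ
    cauchy : IsCauchy seq

open ℝ public

infix 4 _≈_ _≤_ _<_

_≈_ : ℝ → ℝ → Set
x ≈ y = ∀ δ → 0ℚ ℚ.< δ →
  ∃[ N ] (∀ n → N ℕ.≤ n → ∣ seq x n ℚ.- seq y n ∣ ℚ.< δ)

_≤_ : ℝ → ℝ → Set
x ≤ y = ∀ δ → 0ℚ ℚ.< δ →
  ∃[ N ] (∀ n → N ℕ.≤ n → seq x n ℚ.< seq y n ℚ.+ δ)

_<_ : ℝ → ℝ → Set
x < y = ∃[ δ ] (0ℚ ℚ.< δ ×
  ∃[ N ] (∀ n → N ℕ.≤ n → seq x n ℚ.+ δ ℚ.< seq y n))

private
  half : ∀ δ → 0ℚ ℚ.< δ →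
         ∃[ η ] (0ℚ ℚ.< η × η ℚ.+ η ≡ δ)
  half δ 0<δ = ℚ.½ ℚ.* δ , ℚ.positive⁻¹ _ {{ℚ.pos*pos⇒pos ℚ.½ δ {{ℚ.positive 0<δ}}}} ,
    trans (sym (ℚ.*-distribʳ-+ δ ℚ.½ ℚ.½)) (ℚ.*-identityˡ δ)

  +-rearrange : ∀ a b c d →
    (a ℚ.+ b) ℚ.- (c ℚ.+ d) ≡ (a ℚ.- c) ℚ.+ (b ℚ.- d)
  +-rearrange = solve 4 (λ a b c d →
    (a :+ b) :- (c :+ d) := (a :- c) :+ (b :- d)) refl
    where open +-*-Solver

  *-rearrange : ∀ a b c d →
    (a ℚ.* b) ℚ.- (c ℚ.* d) ≡ a ℚ.* (b ℚ.- d) ℚ.+ d ℚ.* (a ℚ.- c)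
  *-rearrange = solve 4 (λ a b c d →
    (a :* b) :- (c :* d) := a :* (b :- d) :+ d :* (a :- c)) refl
    where open +-*-Solver

  split : ∀ a b → a ≡ b ℚ.+ (a ℚ.- b)
  split = solve 2 (λ a b → a := b :+ (a :- b)) refl
    where open +-*-Solver

  +-cauchy : ∀ {x y} → IsCauchy x → IsCauchy y → IsCauchy (λ n → x n ℚ.+ y n)
  +-cauchy {x} {y} cx cy δ 0<δ with half δ 0<δ
  ... | η , 0<η , refl with cx η 0<η | cy η 0<η
  ...   | M , xM | N , yN = M ℕ.+ N , λ m n p q → begin-strict
    ∣ (x m ℚ.+ y m) ℚ.- (x n ℚ.+ y n) ∣       ≡⟨ cong ∣_∣ (+-rearrange (x m) (y m) (x n) (y n)) ⟩
    ∣ (x m ℚ.- x n) ℚ.+ (y m ℚ.- y n) ∣       ≤⟨ ℚ.∣p+q∣≤∣p∣+∣q∣ (x m ℚ.- x n) (y m ℚ.- y n) ⟩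
    ∣ x m ℚ.- x n ∣ ℚ.+ ∣ y m ℚ.- y n ∣       <⟨ ℚ.+-mono-<
        (xM m n (ℕ.m+n≤o⇒m≤o M p) (ℕ.m+n≤o⇒m≤o M q))
        (yN m n (ℕ.m+n≤o⇒n≤o M p) (ℕ.m+n≤o⇒n≤o M q)) ⟩
    η ℚ.+ η ∎
    where open ℚ.≤-Reasoning

  0<1 : 0ℚ ℚ.< 1ℚ
  0<1 = ℚ.positive⁻¹ 1ℚ

  bounded : ∀ {x} → IsCauchy x →
    ∃[ B ] (0ℚ ℚ.< B × ∃[ N ] (∀ n → N ℕ.≤ n → ∣ x n ∣ ℚ.≤ B))
  bounded {x} cx with cx 1ℚ 0<1
  ... | N , xN = ∣ x N ∣ ℚ.+ 1ℚ , ℚ.+-mono-≤-< (ℚ.0≤∣p∣ (x N)) 0<1 , N , λ n p → begin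
    ∣ x n ∣                        ≡⟨ cong ∣_∣ (split (x n) (x N)) ⟩
    ∣ x N ℚ.+ (x n ℚ.- x N) ∣      ≤⟨ ℚ.∣p+q∣≤∣p∣+∣q∣ (x N) (x n ℚ.- x N) ⟩
    ∣ x N ∣ ℚ.+ ∣ x n ℚ.- x N ∣    ≤⟨ ℚ.+-monoʳ-≤ ∣ x N ∣ (ℚ.<⇒≤ (xN n N p ℕ.≤-refl)) ⟩
    ∣ x N ∣ ℚ.+ 1ℚ                 ∎
    where open ℚ.≤-Reasoning

  scale : ∀ B → 0ℚ ℚ.< B → ∀ δ → 0ℚ ℚ.< δ →
          ∃[ η ] (0ℚ ℚ.< η × B ℚ.* η ≡ δ)
  scale B 0<B δ 0<δ = B⁻¹ ℚ.* δ , ℚ.positive⁻¹ _ {{ℚ.pos*pos⇒pos B⁻¹ δ}} ,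
    trans (sym (ℚ.*-assoc B B⁻¹ δ))
      (trans (cong (ℚ._* δ) (ℚ.*-inverseʳ B)) (ℚ.*-identityˡ δ))
    where
    instance
      B>0 = ℚ.positive 0<B
      δ>0 = ℚ.positive 0<δ
      B≢0 = ℚ.pos⇒nonZero B
    B⁻¹ : ℚ
    B⁻¹ = ℚ.1/ B
    instance
      B⁻¹>0 = ℚ.1/pos⇒pos B

  ∣*∣-bound : ∀ {B η} → 0ℚ ℚ.< B → ∀ a b → ∣ a ∣ ℚ.≤ B → ∣ b ∣ ℚ.< η →
              ∣ a ℚ.* b ∣ ℚ.< B ℚ.* η
  ∣*∣-bound {B} {η} 0<B a b a≤B b<η = begin-strict
    ∣ a ℚ.* b ∣       ≡⟨ ℚ.∣p*q∣≡∣p∣*∣q∣ a b ⟩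
    ∣ a ∣ ℚ.* ∣ b ∣   ≤⟨ ℚ.*-monoʳ-≤-nonNeg ∣ b ∣ {{ℚ.∣-∣-nonNeg b}} a≤B ⟩
    B ℚ.* ∣ b ∣       <⟨ ℚ.*-monoʳ-<-pos B {{ℚ.positive 0<B}} b<η ⟩
    B ℚ.* η           ∎
    where open ℚ.≤-Reasoning

  *-close : ∀ {A B α β} → 0ℚ ℚ.< A → 0ℚ ℚ.< B → ∀ a b c d →
            ∣ a ∣ ℚ.≤ A → ∣ d ∣ ℚ.≤ B → ∣ b ℚ.- d ∣ ℚ.< α → ∣ a ℚ.- c ∣ ℚ.< β →
            ∣ (a ℚ.* b) ℚ.- (c ℚ.* d) ∣ ℚ.< A ℚ.* α ℚ.+ B ℚ.* β
  *-close {A} {B} {α} {β} 0<A 0<B a b c d a≤A d≤B b-d a-c = begin-strict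
    ∣ (a ℚ.* b) ℚ.- (c ℚ.* d) ∣
      ≡⟨ cong ∣_∣ (*-rearrange a b c d) ⟩
    ∣ a ℚ.* (b ℚ.- d) ℚ.+ d ℚ.* (a ℚ.- c) ∣
      ≤⟨ ℚ.∣p+q∣≤∣p∣+∣q∣ (a ℚ.* (b ℚ.- d)) (d ℚ.* (a ℚ.- c)) ⟩
    ∣ a ℚ.* (b ℚ.- d) ∣ ℚ.+ ∣ d ℚ.* (a ℚ.- c) ∣
      <⟨ ℚ.+-mono-< (∣*∣-bound 0<A a (b ℚ.- d) a≤A b-d)
                    (∣*∣-bound 0<B d (a ℚ.- c) d≤B a-c) ⟩
    A ℚ.* α ℚ.+ B ℚ.* β ∎
    where open ℚ.≤-Reasoning

  *-cauchy : ∀ {x y} → IsCauchy x → IsCauchy y → IsCauchy (λ n → x n ℚ.* y n)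
  *-cauchy {x} {y} cx cy δ 0<δ =
    let η , 0<η , η+η≡δ   = half δ 0<δ
        A , 0<A , K , xA  = bounded cx
        B , 0<B , L , yB  = bounded cy
        α , 0<α , Aα≡η    = scale A 0<A η 0<η
        β , 0<β , Bβ≡η    = scale B 0<B η 0<η
        M , xM            = cx β 0<β
        N , yN            = cy α 0<α
    in K ℕ.+ (L ℕ.+ (M ℕ.+ N)) , λ m n p q →
      let Lm = ℕ.m+n≤o⇒n≤o K p ; Ln = ℕ.m+n≤o⇒n≤o K q
          Mm = ℕ.m+n≤o⇒n≤o L Lm ; Mn = ℕ.m+n≤o⇒n≤o L Ln
      in subst (∣ (x m ℚ.* y m) ℚ.- (x n ℚ.* y n) ∣ ℚ.<_)
           (trans (cong₂ ℚ._+_ Aα≡η Bβ≡η) η+η≡δ)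
           (*-close 0<A 0<B (x m) (y m) (x n) (y n)
             (xA m (ℕ.m+n≤o⇒m≤o K p)) (yB n (ℕ.m+n≤o⇒m≤o L Ln))
             (yN m n (ℕ.m+n≤o⇒n≤o M Mm) (ℕ.m+n≤o⇒n≤o M Mn))
             (xM m n (ℕ.m+n≤o⇒m≤o M Mm) (ℕ.m+n≤o⇒m≤o M Mn)))

  const-cauchy : ∀ q → IsCauchy (λ _ → q)
  const-cauchy q δ 0<δ = 0 , λ _ _ _ _ →
    subst (ℚ._< δ) (sym (cong ∣_∣ (ℚ.+-inverseʳ q))) 0<δ

infixl 6 _+_
infixl 7 _*_

_+_ : ℝ → ℝ → ℝ
x + y = mkℝ (λ n → seq x n ℚ.+ seq y n)
              (+-cauchy {seq x} {seq y} (cauchy x) (cauchy y))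

_*_ : ℝ → ℝ → ℝ
x * y = mkℝ (λ n → seq x n ℚ.* seq y n)
              (*-cauchy {seq x} {seq y} (cauchy x) (cauchy y))

fromℚ : ℚ → ℝ
fromℚ q = mkℝ (λ _ → q) (const-cauchy q)

0ℝ 1ℝ : ℝ
0ℝ = fromℚ 0ℚ
1ℝ = fromℚ 1ℚ

+-0-rawMonoid : RawMonoid 0ℓ 0ℓ
+-0-rawMonoid = record { Carrier = ℝ ; _≈_ = _≈_ ; _∙_ = _+_ ; ε = 0ℝ }

sum : ∀ {n} → (Fin n → ℝ) → ℝ
sum = RawMonoidDefs.sum +-0-rawMonoid

------------------------------------------------------------------------
-- Finite DAGs, on the vertex set Fin n without loss of generality

record DAG : Set where
  field
    n       : ℕ
    adj     : Fin n → Fin n → Bool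
    acyclic : ∀ v → ¬ TransClosure (λ i j → T (adj i j)) v v

module _ (G : DAG) where

  open DAG G

  V : Set
  V = Fin n

  Edge : V → V → Set
  Edge i j = T (adj i j)

  E : Set
  E = ∃₂ Edge

  -- Weight matrices supported on G are identified with vectors indexed
  -- by E: the entries outside E are all -∞ and carry no information.

  ℝ^E : Set
  ℝ^E = E → ℝ

  sumT : (b : Bool) → (T b → ℝ) → ℝ
  sumT true  f = f tt
  sumT false _ = 0ℝ

  sumE : (E → ℝ) → ℝ
  sumE f = sum λ i → sum λ j → sumT (adj i j) λ e → f (i , j , e)

  ⟨_,_⟩ : ℝ^E → ℝ^E → ℝ
  ⟨ a , x ⟩ = sumE λ e → a e * x e

  ----------------------------------------------------------------------
  -- Convex geometry in ℝ^E

  IsOpenPolyhedralCone : Pred ℝ^E 0ℓ → Set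
  IsOpenPolyhedralCone S =
    Σ[ as ∈ List ℝ^E ]
      All (λ a → ¬ (∀ e → a e ≈ 0ℝ)) as ×
      S ≐ (λ x → All (λ a → 0ℝ < ⟨ a , x ⟩) as)

  AffineHull : Pred ℝ^E 0ℓ → Pred ℝ^E 0ℓ
  AffineHull S x =
    Σ[ k ∈ ℕ ] Σ[ c ∈ (Fin k → ℝ) ] Σ[ p ∈ (Fin k → ℝ^E) ]
      (∀ r → S (p r)) ×
      sum c ≈ 1ℝ ×
      (∀ e → x e ≈ sum λ r → c r * p r e)

  -- The dimension of a convex set is that of its affine hull.

  IsFullDimensional : Pred ℝ^E 0ℓ → Set
  IsFullDimensional S = ∀ x → AffineHull S x

  ----------------------------------------------------------------------
  -- Critical paths

  -- By acyclicity no walk repeats a vertex, so for i ≢ j the directed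
  -- paths from i to j are exactly the walks.

  P : V → V → Set
  P = Star Edge

  ω : ℝ^E → ∀ {i j} → P i j → ℝ
  ω C ε                 = 0ℝ
  ω C (_◅_ {i} {j} e π) = C (i , j , e) + ω C π

  interior : ∀ {i j} → P i j → List V
  interior ε                         = []
  interior (_ ◅ ε)                   = []
  interior (_◅_ {j = k} _ π@(_ ◅ _)) = k ∷ interior π

  Critical : ℝ^E → ∀ {i j} → P i j → Set
  Critical C {i} {j} π = (π′ : P i j) → ω C π′ ≤ ω C π

  Generic : Pred ℝ^E 0ℓ
  Generic C = ∀ i j → i ≢ j → P i j → ∃! {A = P i j} _≡_ (Critical C)

  πcrit : ∀ C → Generic C → ∀ i j → i ≢ j → P i j → P i j
  πcrit C gen i j i≢j π = proj₁ (gen i j i≢j π)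

  ----------------------------------------------------------------------
  -- C*-separation

  CritEdge : ℝ^E → Subset n → V → V → Set
  CritEdge C L i j =
    i ≢ j × P i j ×
    ((π : P i j) → Critical C π → ∀ k → k List.∈ interior π → k ∉ L)

  module _ (C : ℝ^E) (L : Subset n) where

    private
      _⟶_ : V → V → Set
      _⟶_ = CritEdge C L

    -- The vertices of a path are distinct; for distinct i, j ∉ L the
    -- inequalities not listed here follow from _⟶_ being irreflexive
    -- and from membership in L.

    data ConnectingPath (i j : V) : Set where
      pathA : i ⟶ j → ConnectingPath i j
      pathB : ∀ p → p ∉ L →
              p ⟶ i → p ⟶ j → ConnectingPath i j
      pathC : ∀ ℓ → ℓ ∈ L →
              i ⟶ ℓ → j ⟶ ℓ → ConnectingPath i j
      pathD : ∀ p ℓ → p ∉ L → ℓ ∈ L → p ≢ j →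
              p ⟶ i → p ⟶ ℓ → j ⟶ ℓ → ConnectingPath i j
      pathE : ∀ p ℓ q → p ∉ L → ℓ ∈ L → q ∉ L → p ≢ j → q ≢ i → p ≢ q →
              p ⟶ i → p ⟶ ℓ → q ⟶ ℓ → q ⟶ j → ConnectingPath i j

    C*-Connected : V → V → Set
    C*-Connected i j = ConnectingPath i j ⊎ ConnectingPath j i

    C*-Separated : Subset n → Subset n → Set
    C*-Separated I J = ∀ i j → i ∈ I → j ∈ J → ¬ C*-Connected i j

  ----------------------------------------------------------------------
  -- Maxoids and their cones

  -- (I , J , L) stands for the CI statement [ I ⊥⊥ J | L ].

  Maxoid : ℝ^E → Pred (Subset n × Subset n × Subset n) 0ℓ
  Maxoid C (I , J , L) =
    Empty (I ∩ J) × Empty (I ∩ L) × Empty (J ∩ L) × C*-Separated C L I J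

  cone : ℝ^E → Pred ℝ^E 0ℓ
  cone C C′ = Generic C′ × Maxoid C ≐ Maxoid C′

  CriticalInequalities : ∀ C → Generic C → Pred ℝ^E 0ℓ
  CriticalInequalities C gen C′ =
    ∀ i j (i≢j : i ≢ j) (ρ : P i j) (π : P i j) →
      let π* = πcrit C gen i j i≢j ρ in
      π ≢ π* → ω C′ π < ω C′ π*

{-# OPTIONS --safe #-}
module Submission where

open import Level using (0ℓ)
open import Axiom.ExcludedMiddle using (ExcludedMiddle)
open import Data.Product using (_×_)
open import Relation.Unary using (_≐_; _⊆_)
open import Defs

open import Algebra.Bundles using (CommutativeMonoid)
import Algebra.Properties.CommutativeMonoid.Sum as Sum
open import Data.Bool.Base using (true; false; T; if_then_else_)
open import Data.Bool.Properties using (T-irrelevant)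
open import Data.Empty using (⊥-elim)
open import Data.Fin.Base using (Fin; punchIn)
open import Data.Fin.Induction using (spo-noetherian)
open import Data.Fin.Patterns using (0F; 1F; 2F)
import Data.Fin.Properties as Fin
open import Data.Fin.Subset using (Subset; ⁅_⁆; _∈_; _∉_)
open import Data.Fin.Subset.Properties using (x∈⁅x⁆; x∈⁅y⁆⇒x≡y; x∈p∩q⁻)
open import Data.List.Base using (List; []; _∷_; _++_; map; concatMap; filter; allFin)
open import Data.List.Membership.Propositional using () renaming (_∈_ to _∈ˡ_)
open import Data.List.Membership.Propositional.Properties
  using (∈-map⁺; ∈-concatMap⁺; ∈-filter⁺; ∈-filter⁻; ∈-allFin; ∈-++⁺ˡ; ∈-++⁺ʳ)
open import Data.List.Relation.Unary.All as All using (All; []; _∷_)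
import Data.List.Relation.Unary.All.Properties as All
import Data.List.Relation.Unary.Any as Any
open import Data.List.Relation.Unary.Any using (here; there)
open import Data.Nat.Base as ℕ using (ℕ)
import Data.Nat.Properties as ℕ
open import Data.Product using (_,_; proj₁; proj₂; Σ; ∃-syntax; Σ-syntax)
open import Data.Rational.Base as ℚ using (ℚ; 0ℚ; 1ℚ; ½; ∣_∣)
import Data.Rational.Properties as ℚ
open import Data.Rational.Solver using (module +-*-Solver)
open import Data.Sum.Base using (inj₁; inj₂)
open import Data.Unit.Base using (tt)
import Data.Vec.Base as Vec
open import Data.Vec.Functional using (removeAt)
import Data.Vec.Properties as Vec
open import Function.Base using (_∘_; flip)
open import Induction.WellFounded using (Acc; acc)
open import Relation.Binary.Construct.Closure.ReflexiveTransitive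
  using (ε; _◅_; _◅◅_)
open import Relation.Binary.Construct.Closure.Transitive as Transitive
  using (TransClosure; [_]; _∷_)
open import Relation.Binary.PropositionalEquality
  using (_≡_; _≢_; refl; sym; trans; cong; cong₂; subst; module ≡-Reasoning)
import Relation.Binary.PropositionalEquality.Properties as ≡
open import Relation.Binary.Structures using (IsStrictPartialOrder)
open import Relation.Nullary using (¬_; Dec; yes; no; does)
open import Relation.Nullary.Decidable using (dec-true)

-- A generic C and C′ with the same critical paths have the same critical DAGs,
-- hence the same maxoid.  Conversely, follow the critical paths from i to j for
-- C and for C′ until their next vertices k and k′ differ; by acyclicity we may
-- assume that k′ is not an ancestor of k.  Let L consist of k and its ancestors
-- other than i.  Then i and j are separated given L under C: k blocks the
-- critical path, the parents of i lie in L, L contains no descendant of j, and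
-- every parent of a vertex of L, except i, lies in L again.  Under C′ they are
-- adjacent, because the interior of the critical path consists of descendants of
-- k′.  So equal maxoids force equal critical paths, which is the system of
-- inequalities; it is finite since a DAG has finitely many paths.  The cone is
-- full-dimensional because it contains x + M C for every x and all large M.

-- Order on ℝ

p≤∣p∣ : ∀ p → p ℚ.≤ ∣ p ∣
p≤∣p∣ p with 0ℚ ℚ.≤? p
... | yes 0≤p = ℚ.≤-reflexive (sym (ℚ.0≤p⇒∣p∣≡p 0≤p))
... | no  0≰p = ℚ.≤-trans (ℚ.<⇒≤ (ℚ.≰⇒> 0≰p)) (ℚ.0≤∣p∣ p)

-- Since r - s = p - q, both differences have the same sign. The equation is written additively so
-- that it can be supplied by commutative ring identities.
<-transfer : ∀ {p q r s} → p ℚ.< q → r ℚ.+ q ≡ s ℚ.+ p → r ℚ.< s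
<-transfer {p} {q} {r} {s} p<q r+q≡s+p = begin-strict
  r                ≡⟨ add-sub r q ⟩
  (r ℚ.+ q) ℚ.- q  ≡⟨ cong (ℚ._- q) r+q≡s+p ⟩
  (s ℚ.+ p) ℚ.- q  <⟨ ℚ.+-monoˡ-< (ℚ.- q) (ℚ.+-monoʳ-< s p<q) ⟩
  (s ℚ.+ q) ℚ.- q  ≡⟨ add-sub s q ⟨
  s                ∎
  where
  open ℚ.≤-Reasoning
  add-sub : ∀ a b → a ≡ (a ℚ.+ b) ℚ.- b
  add-sub = solve 2 (λ a b → a := (a :+ b) :- b) refl
    where open +-*-Solver

half : ∀ {δ} → 0ℚ ℚ.< δ → ∃[ η ] (0ℚ ℚ.< η × η ℚ.+ η ≡ δ)
half {δ} 0<δ = ½ ℚ.* δ , ℚ.positive⁻¹ _ {{ℚ.pos*pos⇒pos ½ δ {{ℚ.positive 0<δ}}}} ,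
  trans (sym (ℚ.*-distribʳ-+ δ ½ ½)) (ℚ.*-identityˡ δ)

≤-refl : ∀ x → x ≤ x
≤-refl x δ 0<δ = 0 , λ n _ →
  subst (ℚ._< seq x n ℚ.+ δ) (ℚ.+-identityʳ (seq x n)) (ℚ.+-monoʳ-< (seq x n) 0<δ)

≤-trans : ∀ x y z → x ≤ y → y ≤ z → x ≤ z
≤-trans x y z x≤y y≤z δ 0<δ =
  let η , 0<η , η+η≡δ = half 0<δ
      M , xM = x≤y η 0<η
      N , yN = y≤z η 0<η
  in M ℕ.+ N , λ n p → begin-strict
    seq x n                ≤⟨ ℚ.<⇒≤ (xM n (ℕ.m+n≤o⇒m≤o M p)) ⟩
    seq y n ℚ.+ η          <⟨ ℚ.+-monoˡ-< η (yN n (ℕ.m+n≤o⇒n≤o M p)) ⟩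
    (seq z n ℚ.+ η) ℚ.+ η  ≡⟨ trans (ℚ.+-assoc (seq z n) η η) (cong (seq z n ℚ.+_) η+η≡δ) ⟩
    seq z n ℚ.+ δ          ∎
  where open ℚ.≤-Reasoning

<⇒≤ : ∀ x y → x < y → x ≤ y
<⇒≤ x y (η , 0<η , N , x<y) δ 0<δ = N , λ n p → begin-strict
  seq x n        ≡⟨ ℚ.+-identityʳ (seq x n) ⟨
  seq x n ℚ.+ 0ℚ <⟨ ℚ.+-monoʳ-< (seq x n) 0<η ⟩
  seq x n ℚ.+ η  <⟨ x<y n p ⟩
  seq y n        ≡⟨ ℚ.+-identityʳ (seq y n) ⟨
  seq y n ℚ.+ 0ℚ <⟨ ℚ.+-monoʳ-< (seq y n) 0<δ ⟩
  seq y n ℚ.+ δ  ∎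
  where open ℚ.≤-Reasoning

<⇒≱ : ∀ x y → x < y → ¬ y ≤ x
<⇒≱ x y (δ , 0<δ , M , x<y) y≤x =
  let N , y<x = y≤x δ 0<δ
  in ℚ.<-asym (x<y (M ℕ.+ N) (ℕ.m≤m+n M N)) (y<x (M ℕ.+ N) (ℕ.m≤n+m N M))

-- Beyond some N the sequence y - x varies by less than η = δ/2. A single index n past N with
-- `x n + δ ≤ y n` would therefore keep y above x by η at all later indices, which is `x < y`.
≮⇒≥ : ∀ x y → ¬ x < y → y ≤ x
≮⇒≥ x y x≮y δ 0<δ =
  let η , 0<η , η+η≡δ = half 0<δ
      N , close = cauchy (y + fromℚ (ℚ.- 1ℚ) * x) η 0<η
  in N , λ n p → ℚ.≰⇒> λ x+δ≤y → x≮y (η , 0<η , N , λ m q →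
       <-transfer
         (ℚ.+-mono-≤-< x+δ≤y (ℚ.≤-<-trans (p≤∣p∣ _) (close n m p q)))
         (trans (rearrange (seq x m) (seq x n) (seq y m) (seq y n) η)
           (cong (λ t → seq y m ℚ.+ ((seq x n ℚ.+ t) ℚ.+ _)) η+η≡δ)))
  where
  rearrange : ∀ xm xn ym yn η →
    (xm ℚ.+ η) ℚ.+ (yn ℚ.+ η) ≡
    ym ℚ.+ ((xn ℚ.+ (η ℚ.+ η)) ℚ.+
      ((yn ℚ.+ (ℚ.- 1ℚ) ℚ.* xn) ℚ.- (ym ℚ.+ (ℚ.- 1ℚ) ℚ.* xm)))
  rearrange = solve 5 (λ xm xn ym yn η →
    (xm :+ η) :+ (yn :+ η) :=
    ym :+ ((xn :+ (η :+ η)) :+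
      ((yn :+ (:- con 1ℚ) :* xn) :- (ym :+ (:- con 1ℚ) :* xm)))) refl
    where open +-*-Solver

-- x′ − x and y′ − y agree, with both sides moved so that no subtraction occurs.
SameGap : ℝ → ℝ → ℝ → ℝ → Set
SameGap x x′ y y′ = ∀ n → seq y n ℚ.+ seq x′ n ≡ seq y′ n ℚ.+ seq x n

add-both : ∀ a b c d δ → a ℚ.+ b ≡ c ℚ.+ d → (a ℚ.+ δ) ℚ.+ b ≡ c ℚ.+ (d ℚ.+ δ)
add-both a b c d δ eq = begin
  (a ℚ.+ δ) ℚ.+ b  ≡⟨ solve 3 (λ a b δ → (a :+ δ) :+ b := (a :+ b) :+ δ) refl a b δ ⟩
  (a ℚ.+ b) ℚ.+ δ  ≡⟨ cong (ℚ._+ δ) eq ⟩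
  (c ℚ.+ d) ℚ.+ δ  ≡⟨ ℚ.+-assoc c d δ ⟩
  c ℚ.+ (d ℚ.+ δ)  ∎
  where
  open ≡-Reasoning
  open +-*-Solver

sameGap-sym : ∀ x x′ y y′ → SameGap x x′ y y′ → SameGap y y′ x x′
sameGap-sym x x′ y y′ eq n =
  trans (ℚ.+-comm (seq x n) (seq y′ n))
    (trans (sym (eq n)) (ℚ.+-comm (seq y n) (seq x′ n)))

<-sameGap : ∀ x x′ y y′ → SameGap x x′ y y′ → x < x′ → y < y′
<-sameGap x x′ y y′ eq (δ , 0<δ , N , x<x′) =
  δ , 0<δ , N , λ n p →
    <-transfer (x<x′ n p) (add-both (seq y n) (seq x′ n) (seq y′ n) (seq x n) δ (eq n))

≤-sameGap : ∀ x x′ y y′ → SameGap x x′ y y′ → x ≤ x′ → y ≤ y′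
≤-sameGap x x′ y y′ eq x≤x′ δ 0<δ =
  let N , x<x′ = x≤x′ δ 0<δ
  in N , λ n p → <-transfer (x<x′ n p)
       (sym (add-both (seq y′ n) (seq x n) (seq y n) (seq x′ n) δ (sym (eq n))))

-- Eventually u stays above `seq u K` - 1 and v above some rational δ > 0, so u + M v exceeds
-- `seq u K` - 1 + M δ, which grows without bound in M.
positive-ray : ∀ u v → 0ℝ < v →
  ∃[ M₀ ] (∀ M → M₀ ℚ.≤ M → 0ℝ < u + fromℚ M * v)
positive-ray u v (δ , 0<δ , N , 0<v) =
  M₀ , λ M M₀≤M → 1ℚ , 0<1 , K ℕ.+ N , λ n p →
    let uK-un<1 = ℚ.≤-<-trans (p≤∣p∣ _) (close K n ℕ.≤-refl (ℕ.m+n≤o⇒m≤o K p))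
        δ≤vn    = subst (ℚ._≤ seq v n) (ℚ.+-identityˡ δ) (ℚ.<⇒≤ (0<v n (ℕ.m+n≤o⇒n≤o K p)))
        0≤M     = ℚ.≤-trans 0≤M₀ M₀≤M
    in <-transfer
         (ℚ.+-mono-<-≤ uK-un<1 (begin
            (1ℚ ℚ.+ 1ℚ) ℚ.- seq u K    ≤⟨ ℚ.+-monoʳ-≤ (1ℚ ℚ.+ 1ℚ) -uK≤B ⟩
            B                          ≡⟨ M₀δ≡B ⟨
            M₀ ℚ.* δ                   ≤⟨ ℚ.*-monoʳ-≤-nonNeg δ {{ℚ.pos⇒nonNeg δ}} M₀≤M ⟩
            M ℚ.* δ                    ≤⟨ ℚ.*-monoˡ-≤-nonNeg M {{ℚ.nonNegative 0≤M}} δ≤vn ⟩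
            M ℚ.* seq v n              ∎))
         (rearrange (seq u K) (seq u n) (M ℚ.* seq v n))
  where
  open ℚ.≤-Reasoning
  instance
    δ>0 = ℚ.positive 0<δ
    δ≢0 = ℚ.pos⇒nonZero δ
    δ⁻¹>0 = ℚ.1/pos⇒pos δ
  0<1 : 0ℚ ℚ.< 1ℚ
  0<1 = ℚ.positive⁻¹ 1ℚ
  K = proj₁ (cauchy u 1ℚ 0<1)
  close = proj₂ (cauchy u 1ℚ 0<1)
  B M₀ : ℚ
  -- One unit absorbs the variation of u after index K, the other is the positive margin that `_<_`
  -- demands.
  B = (1ℚ ℚ.+ 1ℚ) ℚ.+ ∣ seq u K ∣
  M₀ = B ℚ.* ℚ.1/ δ
  -uK≤B : ℚ.- seq u K ℚ.≤ ∣ seq u K ∣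
  -uK≤B = subst (ℚ.- seq u K ℚ.≤_) (ℚ.∣-p∣≡∣p∣ (seq u K)) (p≤∣p∣ (ℚ.- seq u K))
  M₀δ≡B : M₀ ℚ.* δ ≡ B
  M₀δ≡B = trans (ℚ.*-assoc B (ℚ.1/ δ) δ)
    (trans (cong (B ℚ.*_) (ℚ.*-inverseˡ δ)) (ℚ.*-identityʳ B))
  0≤M₀ : 0ℚ ℚ.≤ M₀
  0≤M₀ = subst (ℚ._≤ M₀) (ℚ.*-zeroˡ (ℚ.1/ δ))
    (ℚ.*-monoʳ-≤-nonNeg (ℚ.1/ δ) {{ℚ.pos⇒nonNeg (ℚ.1/ δ)}}
      (ℚ.+-mono-≤ (ℚ.nonNegative⁻¹ (1ℚ ℚ.+ 1ℚ)) (ℚ.0≤∣p∣ (seq u K))))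
  rearrange : ∀ uK un Mv →
    (0ℚ ℚ.+ 1ℚ) ℚ.+ (1ℚ ℚ.+ Mv) ≡ (un ℚ.+ Mv) ℚ.+ ((uK ℚ.- un) ℚ.+ ((1ℚ ℚ.+ 1ℚ) ℚ.- uK))
  rearrange = solve 3 (λ uK un Mv →
    (con 0ℚ :+ con 1ℚ) :+ (con 1ℚ :+ Mv) :=
    (un :+ Mv) :+ ((uK :- un) :+ ((con 1ℚ :+ con 1ℚ) :- uK))) refl
    where open +-*-Solver

-- Termwise equality of sequences: finer than _≈_, and preserved by all operations.

infix 4 _≋_

record _≋_ (x y : ℝ) : Set where
  constructor termwise
  field at : ∀ n → seq x n ≡ seq y n

open _≋_

≋⇒≈ : ∀ {x y} → x ≋ y → x ≈ y
≋⇒≈ {x} {y} x≋y δ 0<δ = 0 , λ n _ →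
  subst (ℚ._< δ)
    (cong ∣_∣ (sym (trans (cong (ℚ._- seq y n) (at x≋y n)) (ℚ.+-inverseʳ (seq y n)))))
    0<δ

-- The tolerance |q| would give |q| < |q| if q were nonzero. For vectors with rational entries this
-- leads from `_≈_` back to `_≋_`.
fromℚ-≈0 : ∀ q → fromℚ q ≈ 0ℝ → q ≡ 0ℚ
fromℚ-≈0 q q≈0 with 0ℚ ℚ.<? ∣ q ∣
... | yes 0<∣q∣ =
  let N , small = q≈0 ∣ q ∣ 0<∣q∣
  in ⊥-elim (ℚ.<-irrefl (cong ∣_∣ (ℚ.+-identityʳ q)) (small N ℕ.≤-refl))
... | no  0≮∣q∣ = ℚ.∣p∣≡0⇒p≡0 q (ℚ.≤-antisym (ℚ.≮⇒≥ 0≮∣q∣) (ℚ.0≤∣p∣ q))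

fromℚ-0-* : ∀ q x → q ≡ 0ℚ → fromℚ q * x ≋ 0ℝ
fromℚ-0-* _ x refl = termwise λ n → ℚ.*-zeroˡ (seq x n)

0<⇒≋̸0 : ∀ x → 0ℝ < x → ¬ x ≋ 0ℝ
0<⇒≋̸0 x (δ , 0<δ , N , δ<x) x≋0 = ℚ.<-asym 0<δ (begin-strict
  δ            ≡⟨ ℚ.+-identityˡ δ ⟨
  0ℚ ℚ.+ δ     <⟨ δ<x N ℕ.≤-refl ⟩
  seq x N      ≡⟨ at x≋0 N ⟩
  0ℚ           ∎)
  where open ℚ.≤-Reasoning

-- Only the carrier, `_+_` and `0ℝ` enter the definition of `sum`, not the equality, so the sum laws
-- of this monoid apply to `sum` as it stands.
≋-+-commutativeMonoid : CommutativeMonoid 0ℓ 0ℓ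
≋-+-commutativeMonoid = record
  { Carrier = ℝ
  ; _≈_ = _≋_
  ; _∙_ = _+_
  ; ε = 0ℝ
  ; isCommutativeMonoid = record
    { isMonoid = record
      { isSemigroup = record
        { isMagma = record
          { isEquivalence = record
            { refl  = termwise λ _ → refl
            ; sym   = λ p → termwise λ n → sym (at p n)
            ; trans = λ p q → termwise λ n → trans (at p n) (at q n)
            }
          ; ∙-cong = λ p q → termwise λ n → cong₂ ℚ._+_ (at p n) (at q n)
          }
        ; assoc = λ x y z → termwise λ n → ℚ.+-assoc (seq x n) (seq y n) (seq z n)
        }
      ; identity = (λ x → termwise λ n → ℚ.+-identityˡ (seq x n)) ,
                   (λ x → termwise λ n → ℚ.+-identityʳ (seq x n))
      }
    ; comm = λ x y → termwise λ n → ℚ.+-comm (seq x n) (seq y n)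
    }
  }

module ℝ+ = CommutativeMonoid ≋-+-commutativeMonoid
module ℝΣ = Sum ≋-+-commutativeMonoid
open import Relation.Binary.Reasoning.Setoid ℝ+.setoid

sum-zero : ∀ {m} {f : Fin m → ℝ} → (∀ k → f k ≋ 0ℝ) → sum f ≋ 0ℝ
sum-zero {m} f≋0 = ℝ+.trans (ℝΣ.sum-cong-≋ f≋0) (ℝΣ.sum-replicate-zero m)

sum-concentrated : ∀ {m} {f : Fin m → ℝ} i → (∀ k → k ≢ i → f k ≋ 0ℝ) → sum f ≋ f i
sum-concentrated {ℕ.suc m} {f} i f≋0 = begin
  sum f                       ≈⟨ ℝΣ.sum-remove {i = i} f ⟩
  f i + sum (removeAt f i)    ≈⟨ ℝ+.∙-congˡ (sum-zero {f = removeAt f i}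
                                   λ k → f≋0 (punchIn i k) (Fin.punchInᵢ≢i i k)) ⟩
  f i + 0ℝ                    ≈⟨ ℝ+.identityʳ (f i) ⟩
  f i                         ∎

-- Finite enumerations

Finite : Set → Set
Finite A = Σ[ xs ∈ List A ] (∀ x → x ∈ˡ xs)

Fin-finite : ∀ m → Finite (Fin m)
Fin-finite m = allFin m , ∈-allFin

T-finite : ∀ b → Finite (T b)
T-finite true  = tt ∷ [] , λ _ → here refl
T-finite false = [] , λ ()

Σ-finite : ∀ {A : Set} {B : A → Set} → Finite A → (∀ a → Finite (B a)) → Finite (Σ A B)
Σ-finite (as , ∈as) finB =
  concatMap (λ a → map (a ,_) (proj₁ (finB a))) as ,
  λ (a , b) → ∈-concatMap⁺ (λ a → map (a ,_) (proj₁ (finB a)))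
    (Any.map (λ { refl → ∈-map⁺ (a ,_) (proj₂ (finB a) b) }) (∈as a))

×-finite : ∀ {A B : Set} → Finite A → Finite B → Finite (A × B)
×-finite finA finB = Σ-finite finA λ _ → finB

Eventually : (ℚ → Set) → Set
Eventually Q = ∃[ M₀ ] (∀ M → M₀ ℚ.≤ M → Q M)

eventually-all : ∀ {A : Set} {Q : A → ℚ → Set} {xs : List A} →
  All (λ x → Eventually (Q x)) xs → Eventually (λ M → All (λ x → Q x M) xs)
eventually-all []         = 0ℚ , λ _ _ → []
eventually-all (ev ∷ evs) =
  let M₁ , Qx  = ev
      M₂ , Qxs = eventually-all evs
  in M₁ ℚ.⊔ M₂ , λ M M₀≤M →
       Qx M (ℚ.≤-trans (ℚ.p≤p⊔q M₁ M₂) M₀≤M) ∷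
       Qxs M (ℚ.≤-trans (ℚ.p≤q⊔p M₁ M₂) M₀≤M)

does-true : ∀ {Q : Set} (Q? : Dec Q) → does Q? ≡ true → Q
does-true (yes q) _ = q

module _ (em : ExcludedMiddle 0ℓ) (G : DAG) where

  open DAG G

  -- Linear functionals on ℝ^E

  sumT-cong : ∀ b {f g} → (∀ e → f e ≋ g e) → sumT G b f ≋ sumT G b g
  sumT-cong true  f≋g = f≋g tt
  sumT-cong false _   = ℝ+.refl

  sumT-+ : ∀ b f g → sumT G b (λ e → f e + g e) ≋ sumT G b f + sumT G b g
  sumT-+ true  f g = ℝ+.refl
  sumT-+ false f g = ℝ+.sym (ℝ+.identityˡ 0ℝ)

  sumT-zero : ∀ b {f} → (∀ e → f e ≋ 0ℝ) → sumT G b f ≋ 0ℝ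
  sumT-zero true  f≋0 = f≋0 tt
  sumT-zero false _   = ℝ+.refl

  sumT-at : ∀ b f e → sumT G b f ≋ f e
  sumT-at true f e = ℝ+.refl

  sumE-cong : ∀ {f g} → (∀ e → f e ≋ g e) → sumE G f ≋ sumE G g
  sumE-cong f≋g = ℝΣ.sum-cong-≋ λ i → ℝΣ.sum-cong-≋ λ j →
    sumT-cong (adj i j) λ e → f≋g (i , j , e)

  sumE-+ : ∀ f g → sumE G (λ e → f e + g e) ≋ sumE G f + sumE G g
  sumE-+ f g = begin
    (sum λ i → sum λ j → sumT G (adj i j) λ e → f (i , j , e) + g (i , j , e))
      ≈⟨ (ℝΣ.sum-cong-≋ λ i → ℝΣ.sum-cong-≋ λ j →
            sumT-+ (adj i j) (λ e → f (i , j , e)) (λ e → g (i , j , e))) ⟩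
    (sum λ i → sum λ j → F i j + H i j)
      ≈⟨ (ℝΣ.sum-cong-≋ λ i → ℝΣ.∑-distrib-+ (F i) (H i)) ⟩
    (sum λ i → sum (F i) + sum (H i))
      ≈⟨ ℝΣ.∑-distrib-+ (λ i → sum (F i)) (λ i → sum (H i)) ⟩
    sumE G f + sumE G g ∎
    where
    F H : Fin n → Fin n → ℝ
    F i j = sumT G (adj i j) λ e → f (i , j , e)
    H i j = sumT G (adj i j) λ e → g (i , j , e)

  sumE-zero : ∀ {f} → (∀ e → f e ≋ 0ℝ) → sumE G f ≋ 0ℝ
  sumE-zero f≋0 = sum-zero λ i → sum-zero λ j →
    sumT-zero (adj i j) λ e → f≋0 (i , j , e)

  sumE-concentrated : ∀ {f} e → (∀ e′ → e′ ≢ e → f e′ ≋ 0ℝ) → sumE G f ≋ f e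
  sumE-concentrated {f} (i , j , e) f≋0 = begin
    sumE G f
      ≈⟨ (sum-concentrated i λ i′ i′≢i → sum-zero λ j′ → sumT-zero (adj i′ j′) λ e′ →
            f≋0 (i′ , j′ , e′) λ { refl → i′≢i refl }) ⟩
    (sum λ j′ → sumT G (adj i j′) λ e′ → f (i , j′ , e′))
      ≈⟨ (sum-concentrated j λ j′ j′≢j → sumT-zero (adj i j′) λ e′ →
            f≋0 (i , j′ , e′) λ { refl → j′≢j refl }) ⟩
    sumT G (adj i j) (λ e′ → f (i , j , e′))
      ≈⟨ sumT-at (adj i j) (λ e′ → f (i , j , e′)) e ⟩
    f (i , j , e) ∎

  indicator : E G → E G → ℚ
  indicator e e′ = if does (em {P = e′ ≡ e}) then 1ℚ else 0ℚ

  indicator-self : ∀ e → indicator e e ≡ 1ℚ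
  indicator-self e with em {P = e ≡ e}
  ... | yes _   = refl
  ... | no  e≢e = ⊥-elim (e≢e refl)

  indicator-other : ∀ {e e′} → e′ ≢ e → indicator e e′ ≡ 0ℚ
  indicator-other {e} {e′} e′≢e with em {P = e′ ≡ e}
  ... | yes e′≡e = ⊥-elim (e′≢e e′≡e)
  ... | no  _    = refl

  multiplicity : ∀ {i j} → P G i j → E G → ℚ
  multiplicity ε       _  = 0ℚ
  multiplicity (e ◅ π) e′ = indicator (_ , _ , e) e′ ℚ.+ multiplicity π e′

  multiplicity-◅ : ∀ {i k j} (e : Edge G i k) (π : P G k j) e′ →
    multiplicity (e ◅ π) e′ ≡ indicator (i , k , e) e′ ℚ.+ multiplicity π e′
  multiplicity-◅ e π e′ = refl

  -- This makes the weight of a fixed path a linear functional of the weight matrix. Each edge of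
  -- the path contributes a unit vector, and pairing with that vector leaves one entry of x.
  ⟨multiplicity⟩ : ∀ {i j} (π : P G i j) x →
    ⟨_,_⟩ G (λ e → fromℚ (multiplicity π e)) x ≋ ω G x π
  ⟨multiplicity⟩ ε x = sumE-zero λ e → termwise λ m → ℚ.*-zeroˡ (seq (x e) m)
  ⟨multiplicity⟩ (_◅_ {i} {j} e π) x = ℝ+.trans s1 (ℝ+.trans s2 (ℝ+.trans s3 s4))
    where
    e₀ : E G
    e₀ = (i , j , e)
    δ = indicator e₀
    δ-zero : ∀ e′ → e′ ≢ e₀ → fromℚ (δ e′) * x e′ ≋ 0ℝ
    δ-zero e′ e′≢e₀ = fromℚ-0-* (δ e′) (x e′) (indicator-other e′≢e₀)
    f g h : E G → ℝ
    f e′ = fromℚ (multiplicity (e ◅ π) e′) * x e′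
    g e′ = fromℚ (δ e′) * x e′
    h e′ = fromℚ (multiplicity π e′) * x e′
    s1 : sumE G f ≋ sumE G (λ e′ → g e′ + h e′)
    s1 = (sumE-cong λ e′ → termwise λ m →
            trans (cong (ℚ._* seq (x e′) m) (multiplicity-◅ e π e′))
              (ℚ.*-distribʳ-+ (seq (x e′) m) (δ e′) (multiplicity π e′)))
    s2 : sumE G (λ e′ → g e′ + h e′) ≋ sumE G g + sumE G h
    s2 = sumE-+ g h
    s3 : sumE G g + sumE G h ≋ fromℚ (δ e₀) * x e₀ + ω G x π
    s3 = ℝ+.∙-cong (sumE-concentrated e₀ δ-zero) (⟨multiplicity⟩ π x)
    s4 : fromℚ (δ e₀) * x e₀ + ω G x π ≋ x e₀ + ω G x π
    s4 = ℝ+.∙-congʳ {ω G x π} (termwise λ m →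
           trans (cong (ℚ._* seq (x e₀) m) (indicator-self e₀)) (ℚ.*-identityˡ (seq (x e₀) m)))

  -- Normal vectors of the inequalities between path weights

  PathPair : Set
  PathPair = Σ[ i ∈ V G ] Σ[ j ∈ V G ] (P G i j × P G i j)

  Wins : ℝ^E G → PathPair → Set
  Wins C (_ , _ , π , ρ) = ω G C ρ < ω G C π

  difference : PathPair → E G → ℚ
  difference (_ , _ , π , ρ) e = multiplicity π e ℚ.- multiplicity ρ e

  normal : PathPair → ℝ^E G
  normal p e = fromℚ (difference p e)

  ⟨normal⟩ : ∀ {i j} (π ρ : P G i j) x →
    ⟨_,_⟩ G (normal (_ , _ , π , ρ)) x + ω G x ρ ≋ ω G x π
  ⟨normal⟩ π ρ x = begin
    ⟨_,_⟩ G (normal (_ , _ , π , ρ)) x + ω G x ρ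
      ≈⟨ ℝ+.∙-congˡ (⟨multiplicity⟩ ρ x) ⟨
    ⟨_,_⟩ G (normal (_ , _ , π , ρ)) x + ⟨_,_⟩ G (λ e → fromℚ (multiplicity ρ e)) x
      ≈⟨ sumE-+ (λ e → normal (_ , _ , π , ρ) e * x e) (λ e → fromℚ (multiplicity ρ e) * x e) ⟨
    (sumE G λ e → normal (_ , _ , π , ρ) e * x e + fromℚ (multiplicity ρ e) * x e)
      ≈⟨ (sumE-cong λ e → termwise λ m →
            rearrange (multiplicity π e) (multiplicity ρ e) (seq (x e) m)) ⟩
    ⟨_,_⟩ G (λ e → fromℚ (multiplicity π e)) x
      ≈⟨ ⟨multiplicity⟩ π x ⟩
    ω G x π ∎
    where
    rearrange : ∀ p q r → (p ℚ.- q) ℚ.* r ℚ.+ q ℚ.* r ≡ p ℚ.* r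
    rearrange = solve 3 (λ p q r → (p :- q) :* r :+ q :* r := p :* r) refl
      where open +-*-Solver

  -- In this form the signs of the pairing and of the weight difference determine each other,
  -- through `<-sameGap` in both directions.
  normal-gap : ∀ {i j} (π ρ : P G i j) x →
    SameGap 0ℝ (⟨_,_⟩ G (normal (_ , _ , π , ρ)) x) (ω G x ρ) (ω G x π)
  normal-gap π ρ x m =
    trans (ℚ.+-comm (seq (ω G x ρ) m) (seq (⟨_,_⟩ G (normal (_ , _ , π , ρ)) x) m))
      (trans (at (⟨normal⟩ π ρ x) m) (sym (ℚ.+-identityʳ (seq (ω G x π) m))))

  normal-positive⁺ : ∀ p x → Wins x p → 0ℝ < ⟨_,_⟩ G (normal p) x
  normal-positive⁺ (_ , _ , π , ρ) x = <-sameGap (ω G x ρ) (ω G x π) 0ℝ (⟨_,_⟩ G (normal (_ , _ , π , ρ)) x)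
    (sameGap-sym 0ℝ (⟨_,_⟩ G (normal (_ , _ , π , ρ)) x) (ω G x ρ) (ω G x π) (normal-gap π ρ x))

  normal-positive⁻ : ∀ p x → 0ℝ < ⟨_,_⟩ G (normal p) x → Wins x p
  normal-positive⁻ (_ , _ , π , ρ) x = <-sameGap 0ℝ (⟨_,_⟩ G (normal (_ , _ , π , ρ)) x) (ω G x ρ) (ω G x π)
    (normal-gap π ρ x)

  -- A zero vector pairs to zero with x, whereas the pairing is positive wherever the first path
  -- wins.
  normal-nonzero : ∀ p x → Wins x p → ¬ (∀ e → normal p e ≈ 0ℝ)
  normal-nonzero p x wins normal≈0 =
    0<⇒≋̸0 (⟨_,_⟩ G (normal p) x) (normal-positive⁺ p x wins)
      (sumE-zero {λ e → normal p e * x e} λ e → termwise λ m →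
        trans (cong (ℚ._* seq (x e) m) (fromℚ-≈0 (difference p e) (normal≈0 e)))
          (ℚ.*-zeroˡ (seq (x e) m)))

  -- Paths

  ◅⇒⁺ : ∀ {i k j} → Edge G i k → P G k j → TransClosure (Edge G) i j
  ◅⇒⁺ e ε       = [ e ]
  ◅⇒⁺ e (f ◅ π) = e ∷ ◅⇒⁺ f π

  no-cycle : ∀ {i k} → Edge G i k → ¬ P G k i
  no-cycle e π = acyclic _ (◅⇒⁺ e π)

  edge-≢ : ∀ {i k j} → Edge G i k → P G k j → i ≢ j
  edge-≢ e π refl = no-cycle e π

  P-antisym : ∀ {i j} → P G i j → P G j i → i ≡ j
  P-antisym ε       _ = refl
  P-antisym (e ◅ π) ρ = ⊥-elim (no-cycle e (π ◅◅ ρ))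

  loop-ε : ∀ {i} (π : P G i i) → π ≡ ε
  loop-ε ε       = refl
  loop-ε (e ◅ π) = ⊥-elim (no-cycle e π)

  head-∈-interior : ∀ {i k j} (e : Edge G i k) (π : P G k j) → k ≢ j →
    k ∈ˡ interior G (e ◅ π)
  head-∈-interior e ε       k≢j = ⊥-elim (k≢j refl)
  head-∈-interior e (f ◅ π) _   = here refl

  head-reaches-interior : ∀ {i k j} (e : Edge G i k) (π : P G k j) {v} →
    v ∈ˡ interior G (e ◅ π) → P G k v
  head-reaches-interior e (f ◅ π) (here refl) = ε
  head-reaches-interior e (f ◅ π) (there v∈)  = f ◅ head-reaches-interior f π v∈

  -- By Noetherian induction along the edges: a path is trivial or consists of one of finitely many
  -- edges followed by a path from a proper descendant of i.
  paths-finite : ∀ i j → Finite (P G i j)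
  paths-finite i = go i (spo-noetherian isSPO i)
    where
    isSPO : IsStrictPartialOrder _≡_ (TransClosure (Edge G))
    isSPO = record
      { isEquivalence = ≡.isEquivalence
      ; irrefl = λ { refl → acyclic _ }
      ; trans = Transitive._++_
      ; <-resp-≈ = (λ { refl p → p }) , (λ { refl p → p })
      }

    trivial : ∀ i j → List (P G i j)
    trivial i j with i Fin.≟ j
    ... | yes refl = ε ∷ []
    ... | no  _    = []

    ε∈trivial : ∀ i → ε ∈ˡ trivial i i
    ε∈trivial i with i Fin.≟ i
    ... | yes refl = here refl
    ... | no  i≢i  = ⊥-elim (i≢i refl)

    go : ∀ i → Acc (flip (TransClosure (Edge G))) i → ∀ j → Finite (P G i j)
    go i (acc rec) j = trivial i j ++ map cons (proj₁ steps) , complete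
      where
      Step : Set
      Step = Σ[ k ∈ V G ] Σ[ e ∈ Edge G i k ] P G k j
      cons : Step → P G i j
      cons (_ , e , π) = e ◅ π
      steps : Finite Step
      steps = Σ-finite (Fin-finite n) λ k → Σ-finite (T-finite (adj i k)) λ e →
        go k (rec [ e ]) j
      complete : ∀ π → π ∈ˡ trivial i j ++ map cons (proj₁ steps)
      complete ε       = ∈-++⁺ˡ (ε∈trivial i)
      complete (e ◅ π) = ∈-++⁺ʳ (trivial i j) (∈-map⁺ cons (proj₂ steps (_ , e , π)))

  -- Critical paths

  -- Prefixing the edge e adds the same weight to every path from k to j, so a heavier tail would
  -- give a heavier path from i.
  critical-tail : ∀ C {i k j} (e : Edge G i k) (π : P G k j) →
    Critical G C (e ◅ π) → Critical G C π
  critical-tail C e π crit ρ =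
    ≤-sameGap (ω G C (e ◅ ρ)) (ω G C (e ◅ π)) (ω G C ρ) (ω G C π)
      (λ m → rearrange (seq (C (_ , _ , e)) m) (seq (ω G C π) m) (seq (ω G C ρ) m))
      (crit (e ◅ ρ))
    where
    rearrange : ∀ c p r → r ℚ.+ (c ℚ.+ p) ≡ p ℚ.+ (c ℚ.+ r)
    rearrange = solve 3 (λ c p r → r :+ (c :+ p) := p :+ (c :+ r)) refl
      where open +-*-Solver

  critical-unique : ∀ {C i j} → Generic G C → i ≢ j → (π ρ : P G i j) →
    Critical G C π → Critical G C ρ → π ≡ ρ
  critical-unique gen i≢j π ρ critπ critρ with gen _ _ i≢j π
  ... | _ , _ , unique = trans (sym (unique critπ)) (unique critρ)

  -- A path that is not strictly lighter than a critical one is at least as heavy as all others,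
  -- hence critical itself, against uniqueness.
  critical-strict : ∀ {C i j} → Generic G C → i ≢ j → (π ρ : P G i j) →
    Critical G C π → ρ ≢ π → ω G C ρ < ω G C π
  critical-strict {C} gen i≢j π ρ critπ ρ≢π with em {P = ω G C ρ < ω G C π}
  ... | yes ρ<π = ρ<π
  ... | no  ρ≮π = ⊥-elim (ρ≢π (critical-unique {C} gen i≢j ρ π
    (λ σ → ≤-trans (ω G C σ) (ω G C π) (ω G C ρ) (critπ σ)
      (≮⇒≥ (ω G C ρ) (ω G C π) ρ≮π))
    critπ))

  -- The system of inequalities, quantified over all critical paths of C instead of the one chosen
  -- by `πcrit`. It needs no genericity witness and mediates between the cone and
  -- `CriticalInequalities`.
  Dominates : ℝ^E G → ℝ^E G → Set
  Dominates C C′ = ∀ {i j} → i ≢ j → (π ρ : P G i j) →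
    Critical G C π → ρ ≢ π → ω G C′ ρ < ω G C′ π

  dominates⇒critical : ∀ C C′ {i j} → Dominates C C′ → i ≢ j → (π : P G i j) →
    Critical G C π → Critical G C′ π
  dominates⇒critical C C′ dom i≢j π critπ ρ with em {P = ρ ≡ π}
  ... | yes refl = ≤-refl (ω G C′ π)
  ... | no  ρ≢π  = <⇒≤ (ω G C′ ρ) (ω G C′ π) (dom i≢j π ρ critπ ρ≢π)

  -- If π were not the critical path of C, that path would be strictly heavier than π under C′.
  dominates⇒critical⁻ : ∀ C C′ {i j} → Generic G C → Dominates C C′ → i ≢ j →
    (π : P G i j) → Critical G C′ π → Critical G C π
  dominates⇒critical⁻ C C′ gen dom i≢j π crit′ with gen _ _ i≢j π
  ... | π* , crit* , _ with em {P = π ≡ π*}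
  ...   | yes refl = crit*
  ...   | no  π≢π* = ⊥-elim
    (<⇒≱ (ω G C′ π) (ω G C′ π*) (dom i≢j π* π crit* π≢π*) (crit′ π*))

  dominates⇒generic : ∀ C C′ → Generic G C → Dominates C C′ → Generic G C′
  dominates⇒generic C C′ gen dom i j i≢j π with gen i j i≢j π
  ... | π* , crit* , unique =
    π* , dominates⇒critical C C′ dom i≢j π* crit* ,
    λ {ρ} crit′ → unique (dominates⇒critical⁻ C C′ gen dom i≢j ρ crit′)

  -- Dependence of C*-separation on the critical paths

  module _ (C C′ : ℝ^E G) (L : Subset n)
    (critical⇐ : ∀ {i j} → i ≢ j → (π : P G i j) → Critical G C′ π → Critical G C π)
    where

    -- An edge requires every critical path to avoid L. The critical paths of C′ are among those of
    -- C, so C′ imposes fewer conditions.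
    critEdge-mono : ∀ {i j} → CritEdge G C L i j → CritEdge G C′ L i j
    critEdge-mono (i≢j , π , avoid) =
      i≢j , π , λ ρ crit′ → avoid ρ (critical⇐ i≢j ρ crit′)

    connectingPath-mono : ∀ {i j} → ConnectingPath G C L i j → ConnectingPath G C′ L i j
    connectingPath-mono (pathA a) = pathA (critEdge-mono a)
    connectingPath-mono (pathB p p∉ a b) =
      pathB p p∉ (critEdge-mono a) (critEdge-mono b)
    connectingPath-mono (pathC ℓ ℓ∈ a b) =
      pathC ℓ ℓ∈ (critEdge-mono a) (critEdge-mono b)
    connectingPath-mono (pathD p ℓ p∉ ℓ∈ p≢j a b c) =
      pathD p ℓ p∉ ℓ∈ p≢j (critEdge-mono a) (critEdge-mono b) (critEdge-mono c)
    connectingPath-mono (pathE p ℓ q p∉ ℓ∈ q∉ p≢j q≢i p≢q a b c d) =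
      pathE p ℓ q p∉ ℓ∈ q∉ p≢j q≢i p≢q
        (critEdge-mono a) (critEdge-mono b) (critEdge-mono c) (critEdge-mono d)

    separated-anti : ∀ {I J} → C*-Separated G C′ L I J → C*-Separated G C L I J
    separated-anti sep i j i∈I j∈J (inj₁ path) =
      sep i j i∈I j∈J (inj₁ (connectingPath-mono path))
    separated-anti sep i j i∈I j∈J (inj₂ path) =
      sep i j i∈I j∈J (inj₂ (connectingPath-mono path))

  dominates⇒cone : ∀ C C′ → Generic G C → Dominates C C′ → cone G C C′
  dominates⇒cone C C′ gen dom =
    dominates⇒generic C C′ gen dom ,
    (λ {(I , J , L)} (IJ , IL , JL , sep) → IJ , IL , JL ,
      separated-anti C′ C L (dominates⇒critical C C′ dom) {I} {J} sep) ,
    (λ {(I , J , L)} (IJ , IL , JL , sep) → IJ , IL , JL ,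
      separated-anti C C′ L (dominates⇒critical⁻ C C′ gen dom) {I} {J} sep)

  -- The maxoid determines the critical paths

  subset : (V G → Set) → Subset n
  subset Q = Vec.tabulate λ v → does (em {P = Q v})

  ∈-subset⁺ : ∀ {Q v} → Q v → v ∈ subset Q
  ∈-subset⁺ {Q} {v} q = Vec.lookup⇒[]= v (subset Q)
    (trans (Vec.lookup∘tabulate _ v) (dec-true em q))

  ∈-subset⁻ : ∀ {Q v} → v ∈ subset Q → Q v
  ∈-subset⁻ {Q} {v} v∈ = does-true em
    (trans (sym (Vec.lookup∘tabulate _ v)) (Vec.[]=⇒lookup v∈))

  module _ {C : ℝ^E G} {i k j} (e : Edge G i k) (π : P G k j)
    (crit : Critical G C (e ◅ π)) (k≢j : k ≢ j) where

    -- The trivial path puts k itself into this set, while i stays outside so that it can be an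
    -- endpoint of the CI statement.
    properAncestors : Subset n
    properAncestors = subset λ v → v ≢ i × P G v k

    private
      L : Subset n
      L = properAncestors

    ∈L⁺ : ∀ {v} → v ≢ i → P G v k → v ∈ L
    ∈L⁺ v≢i π = ∈-subset⁺ (v≢i , π)

    L-reaches-k : ∀ {v} → v ∈ L → P G v k
    L-reaches-k = proj₂ ∘ ∈-subset⁻

    i∉L : i ∉ L
    i∉L i∈L = proj₁ (∈-subset⁻ i∈L) refl

    -- A path from j into L continues to k, and π returns from k to j, so acyclicity would force k =
    -- j.
    j-above-L : ∀ {v} → v ∈ L → ¬ P G j v
    j-above-L v∈L j→v = k≢j (P-antisym π (j→v ◅◅ L-reaches-k v∈L))

    -- Whatever reaches i also reaches k through the edge e, and so belongs to L. This excludes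
    -- every connecting path that enters i from outside L.
    i-parentless : ∀ {v} → v ∉ L → ¬ CritEdge G C L v i
    i-parentless v∉L (v≢i , v→i , _) = v∉L (∈L⁺ v≢i (v→i ◅◅ e ◅ ε))

    i-j-separated : ¬ ConnectingPath G C L i j
    i-j-separated (pathA (_ , _ , avoid)) =
      avoid (e ◅ π) crit k (head-∈-interior e π k≢j) (∈L⁺ (edge-≢ e ε ∘ sym) ε)
    i-j-separated (pathB p p∉L p→i _)                   = i-parentless p∉L p→i
    i-j-separated (pathC ℓ ℓ∈L _ (_ , j→ℓ , _))         = j-above-L ℓ∈L j→ℓ
    i-j-separated (pathD p ℓ p∉L _ _ p→i _ _)           = i-parentless p∉L p→i
    i-j-separated (pathE p ℓ q p∉L _ _ _ _ _ p→i _ _ _) = i-parentless p∉L p→i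

    j-i-separated : ¬ ConnectingPath G C L j i
    j-i-separated (pathA (_ , j→i , _))          = no-cycle e (π ◅◅ j→i)
    j-i-separated (pathB p p∉L _ p→i)            = i-parentless p∉L p→i
    j-i-separated (pathC ℓ ℓ∈L (_ , j→ℓ , _) _)  = j-above-L ℓ∈L j→ℓ
    -- Here i is the parent of the collider ℓ, so p need not reach i. Instead p reaches k through ℓ,
    -- and p differs from i because the vertices of a connecting path are distinct.
    j-i-separated (pathD p ℓ p∉L ℓ∈L p≢i _ (_ , p→ℓ , _) _) =
      p∉L (∈L⁺ p≢i (p→ℓ ◅◅ L-reaches-k ℓ∈L))
    j-i-separated (pathE p ℓ q _ _ q∉L _ _ _ _ _ _ q→i) = i-parentless q∉L q→i

    properAncestors-separate : Maxoid G C (⁅ i ⁆ , ⁅ j ⁆ , L)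
    properAncestors-separate =
      (λ (v , v∈) → let v∈i , v∈j = x∈p∩q⁻ ⁅ i ⁆ ⁅ j ⁆ v∈ in
        edge-≢ e π (trans (sym (x∈⁅y⁆⇒x≡y i v∈i)) (x∈⁅y⁆⇒x≡y j v∈j))) ,
      (λ (v , v∈) → let v∈i , v∈L = x∈p∩q⁻ ⁅ i ⁆ L v∈ in
        i∉L (subst (_∈ L) (x∈⁅y⁆⇒x≡y i v∈i) v∈L)) ,
      (λ (v , v∈) → let v∈j , v∈L = x∈p∩q⁻ ⁅ j ⁆ L v∈ in
        j-above-L (subst (_∈ L) (x∈⁅y⁆⇒x≡y j v∈j) v∈L) ε) ,
      separated
      where
      separated : C*-Separated G C L ⁅ i ⁆ ⁅ j ⁆
      separated v w v∈ w∈ with x∈⁅y⁆⇒x≡y i v∈ | x∈⁅y⁆⇒x≡y j w∈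
      ... | refl | refl = λ { (inj₁ path) → i-j-separated path
                            ; (inj₂ path) → j-i-separated path }

  -- Each inclusion of maxoids gives one direction of reachability. With the roles of C and C′
  -- exchanged, the two directions together force k = k′ by acyclicity.
  second-vertex-reaches : ∀ {C C′ i k k′ j} → Generic G C′ → Maxoid G C ⊆ Maxoid G C′ →
    (e : Edge G i k) (π : P G k j) (e′ : Edge G i k′) (π′ : P G k′ j) →
    Critical G C (e ◅ π) → Critical G C′ (e′ ◅ π′) → P G k′ k
  second-vertex-reaches {i = i} {k} {k′} {j} gen′ M⊆M′ e π e′ π′ crit crit′
    with em {P = P G k′ k}
  ... | yes k′→k = k′→k
  ... | no  k′↛k = ⊥-elim (sep i j (x∈⁅x⁆ i) (x∈⁅x⁆ j) (inj₁ (pathA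
          (edge-≢ e π , e ◅ π , avoid))))
    where
    k≢j : k ≢ j
    -- If k were j, then π′ would already lead from k′ to k.
    k≢j refl = k′↛k π′
    L = properAncestors e π crit k≢j
    sep = proj₂ (proj₂ (proj₂ (M⊆M′ (properAncestors-separate e π crit k≢j))))
    avoid : ∀ σ → Critical G _ σ → ∀ v → v ∈ˡ interior G σ → v ∉ L
    avoid σ critσ v v∈σ v∈L with critical-unique gen′ (edge-≢ e π) σ (e′ ◅ π′) critσ crit′
    ... | refl = k′↛k (head-reaches-interior e′ π′ v∈σ ◅◅ L-reaches-k e π crit k≢j v∈L)

  -- Induction along both paths: the second vertices reach each other and hence coincide, parallel
  -- edges do not exist, and the tails are again critical.
  critical-paths-agree : ∀ {C C′} → Generic G C → Generic G C′ → Maxoid G C ≐ Maxoid G C′ →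
    ∀ {i j} (π π′ : P G i j) → Critical G C π → Critical G C′ π′ → π ≡ π′
  critical-paths-agree gen gen′ M≐M′ ε π′ _ _ = sym (loop-ε π′)
  critical-paths-agree gen gen′ M≐M′ π@(_ ◅ _) ε _ _ = loop-ε π
  critical-paths-agree {C} {C′} gen gen′ M≐M′ (e ◅ π) (e′ ◅ π′) crit crit′
    with P-antisym
      (second-vertex-reaches gen (proj₂ M≐M′) e′ π′ e π crit′ crit)
      (second-vertex-reaches gen′ (proj₁ M≐M′) e π e′ π′ crit crit′)
  ... | refl = cong₂ _◅_ (T-irrelevant e e′)
    (critical-paths-agree gen gen′ M≐M′ π π′
      (critical-tail C e π crit) (critical-tail C′ e′ π′ crit′))

  -- Equality of the cone with the solution set of the inequalities

  cone⇒dominates : ∀ {C C′} → Generic G C → cone G C C′ → Dominates C C′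
  cone⇒dominates gen (gen′ , M≐M′) i≢j π ρ critπ ρ≢π with gen′ _ _ i≢j π
  ... | π* , crit* , _ with critical-paths-agree gen gen′ M≐M′ π π* critπ crit*
  ...   | refl = critical-strict gen′ i≢j π ρ crit* ρ≢π

  -- Uniqueness identifies the chosen critical path with π, and π itself also serves as the witness
  -- that P(i,j) is nonempty.
  inequalities⇒dominates : ∀ C gen {C′} →
    CriticalInequalities G C gen C′ → Dominates C C′
  inequalities⇒dominates C gen {C′} ineq {i} {j} i≢j π ρ crit ρ≢π =
    subst (λ σ → ω G C′ ρ < ω G C′ σ) π*≡π
      (ineq i j i≢j π ρ (λ ρ≡π* → ρ≢π (trans ρ≡π* π*≡π)))
    where
    π*≡π : πcrit G C gen i j i≢j π ≡ π
    π*≡π = proj₂ (proj₂ (gen i j i≢j π)) crit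

  dominates⇒inequalities : ∀ C gen {C′} →
    Dominates C C′ → CriticalInequalities G C gen C′
  dominates⇒inequalities C gen dom i j i≢j ρ π =
    dom i≢j (πcrit G C gen i j i≢j ρ) π (proj₁ (proj₂ (gen i j i≢j ρ)))

  cone≐inequalities : ∀ C gen → cone G C ≐ CriticalInequalities G C gen
  cone≐inequalities C gen =
    (λ {C′} → dominates⇒inequalities C gen {C′} ∘ cone⇒dominates gen) ,
    (λ {C′} → dominates⇒cone C C′ gen ∘ inequalities⇒dominates C gen {C′})

  -- Open and full-dimensional

  pathPairs-finite : Finite PathPair
  pathPairs-finite = Σ-finite (Fin-finite n) λ i → Σ-finite (Fin-finite n) λ j →
    ×-finite (paths-finite i j) (paths-finite i j)

  Competing : ℝ^E G → PathPair → Set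
  Competing C (i , j , π , ρ) = i ≢ j × Critical G C π × ρ ≢ π

  module _ (C : ℝ^E G) (gen : Generic G C) where

    competing? : ∀ p → Dec (Competing C p)
    competing? p = em

    competitors : List PathPair
    competitors = filter competing? (proj₁ pathPairs-finite)

    dominates⇒wins : ∀ {x} → Dominates C x → All (Wins x) competitors
    dominates⇒wins dom = All.tabulate λ {(_ , _ , π , ρ)} p∈ →
      let i≢j , crit , ρ≢π = proj₂ (∈-filter⁻ competing? {xs = proj₁ pathPairs-finite} p∈)
      in dom i≢j π ρ crit ρ≢π

    wins⇒dominates : ∀ {x} → All (Wins x) competitors → Dominates C x
    wins⇒dominates wins {i} {j} i≢j π ρ crit ρ≢π = All.lookup wins
      (∈-filter⁺ competing? (proj₂ pathPairs-finite (i , j , π , ρ)) (i≢j , crit , ρ≢π))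

    self-dominates : Dominates C C
    self-dominates i≢j π ρ = critical-strict gen i≢j π ρ

    cone-isOpenPolyhedral : IsOpenPolyhedralCone G (cone G C)
    cone-isOpenPolyhedral =
      map normal competitors ,
      -- The point C satisfies all the inequalities strictly, so none of the normals vanishes.
      All.map⁺ (All.map (λ {p} → normal-nonzero p C) (dominates⇒wins {C} self-dominates)) ,
      (λ {x} x∈ → All.map⁺ (All.map (λ {p} → normal-positive⁺ p x)
        (dominates⇒wins {x} (cone⇒dominates gen x∈)))) ,
      (λ {x} pos → dominates⇒cone C x gen (wins⇒dominates {x}
        (All.map (λ {p} → normal-positive⁻ p x) (All.map⁻ pos))))

    -- Rays in direction C that end up in the cone

    ray : ℝ^E G → ℚ → ℝ^E G
    ray x M e = x e + fromℚ M * C e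

    ω-ray : ∀ x M {i j} (π : P G i j) m →
      seq (ω G (ray x M) π) m ≡ seq (ω G x π) m ℚ.+ M ℚ.* seq (ω G C π) m
    ω-ray x M ε       m = sym (trans (ℚ.+-identityˡ (M ℚ.* 0ℚ)) (ℚ.*-zeroʳ M))
    ω-ray x M (e ◅ π) m = trans
      (cong (seq (x e₀) m ℚ.+ M ℚ.* seq (C e₀) m ℚ.+_) (ω-ray x M π m))
      (rearrange (seq (x e₀) m) M (seq (C e₀) m) (seq (ω G x π) m) (seq (ω G C π) m))
      where
      e₀ : E G
      e₀ = _ , _ , e
      rearrange : ∀ a M b c d →
        (a ℚ.+ M ℚ.* b) ℚ.+ (c ℚ.+ M ℚ.* d) ≡ (a ℚ.+ c) ℚ.+ M ℚ.* (b ℚ.+ d)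
      rearrange = solve 5 (λ a M b c d →
        (a :+ M :* b) :+ (c :+ M :* d) := (a :+ c) :+ M :* (b :+ d)) refl
        where open +-*-Solver

    -- The weight difference of the two paths is linear in the weight matrix: along the ray it
    -- equals `gap x` + M `gap C`, with `gap C` positive.
    ray-wins : ∀ x p → Wins C p → Eventually (λ M → Wins (ray x M) p)
    ray-wins x (_ , _ , π , ρ) ρ<π =
      let M₀ , positive = positive-ray (gap x) (gap C)
            (<-sameGap (ω G C ρ) (ω G C π) 0ℝ (gap C)
              (λ m → rearrange₀ (seq (ω G C π) m) (seq (ω G C ρ) m)) ρ<π)
      in M₀ , λ M M₀≤M →
        <-sameGap 0ℝ (gap x + fromℚ M * gap C) (ω G (ray x M) ρ) (ω G (ray x M) π)
          (sameGap M) (positive M M₀≤M)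
      where
      gap : ℝ^E G → ℝ
      gap y = ω G y π + fromℚ (ℚ.- 1ℚ) * ω G y ρ
      rearrange₀ : ∀ a b → 0ℚ ℚ.+ a ≡ (a ℚ.+ (ℚ.- 1ℚ) ℚ.* b) ℚ.+ b
      rearrange₀ = solve 2 (λ a b →
        con 0ℚ :+ a := (a :+ (:- con 1ℚ) :* b) :+ b) refl
        where open +-*-Solver
      rearrange₁ : ∀ a b M c d →
        (b ℚ.+ M ℚ.* d) ℚ.+
          ((a ℚ.+ (ℚ.- 1ℚ) ℚ.* b) ℚ.+ M ℚ.* (c ℚ.+ (ℚ.- 1ℚ) ℚ.* d))
        ≡ (a ℚ.+ M ℚ.* c) ℚ.+ 0ℚ
      rearrange₁ = solve 5 (λ a b M c d →
        (b :+ M :* d) :+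
          ((a :+ (:- con 1ℚ) :* b) :+ M :* (c :+ (:- con 1ℚ) :* d))
        := (a :+ M :* c) :+ con 0ℚ) refl
        where open +-*-Solver
      sameGap : ∀ M →
        SameGap 0ℝ (gap x + fromℚ M * gap C) (ω G (ray x M) ρ) (ω G (ray x M) π)
      sameGap M m = trans
        (cong (ℚ._+ (seq (gap x) m ℚ.+ M ℚ.* seq (gap C) m)) (ω-ray x M ρ m))
        (trans
          (rearrange₁ (seq (ω G x π) m) (seq (ω G x ρ) m) M (seq (ω G C π) m) (seq (ω G C ρ) m))
          (cong (ℚ._+ 0ℚ) (sym (ω-ray x M π m))))

    -- There are finitely many inequalities, so the maximum of their thresholds works for all of
    -- them at once.
    ray-∈-cone : ∀ x → Eventually (λ M → cone G C (ray x M))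
    ray-∈-cone x =
      let M₀ , wins = eventually-all {Q = λ p M → Wins (ray x M) p}
            (All.map (λ {p} → ray-wins x p) (dominates⇒wins {C} self-dominates))
      in M₀ , λ M M₀≤M → dominates⇒cone C (ray x M) gen (wins⇒dominates {ray x M} (wins M M₀≤M))

    -- x = (x + M C) + C − (M + 1) C, where all three points lie in the cone for large M.
    cone-isFullDimensional : IsFullDimensional G (cone G C)
    cone-isFullDimensional x =
      3 , coefficient , point , point∈cone , ≋⇒≈ sum≋1 , λ e → ≋⇒≈ (x≋ e)
      where
      0^E : ℝ^E G
      0^E _ = 0ℝ
      M₁ = proj₁ (ray-∈-cone x)
      M₂ = proj₁ (ray-∈-cone 0^E)
      -- One M serves both rays: the ray from x is taken at M, the ray from the origin at M + 1.
      M = M₁ ℚ.⊔ M₂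
      M₂≤M+1 : M₂ ℚ.≤ M ℚ.+ 1ℚ
      M₂≤M+1 = ℚ.≤-trans (ℚ.p≤q⊔p M₁ M₂)
        (subst (ℚ._≤ M ℚ.+ 1ℚ) (ℚ.+-identityʳ M) (ℚ.+-monoʳ-≤ M (ℚ.nonNegative⁻¹ 1ℚ)))
      coefficient : Fin 3 → ℝ
      coefficient 0F = 1ℝ
      coefficient 1F = 1ℝ
      coefficient 2F = fromℚ (ℚ.- 1ℚ)
      point : Fin 3 → ℝ^E G
      point 0F = ray x M
      point 1F = C
      point 2F = ray 0^E (M ℚ.+ 1ℚ)
      point∈cone : ∀ r → cone G C (point r)
      point∈cone 0F = proj₂ (ray-∈-cone x) M (ℚ.p≤p⊔q M₁ M₂)
      point∈cone 1F = dominates⇒cone C C gen self-dominates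
      point∈cone 2F = proj₂ (ray-∈-cone 0^E) (M ℚ.+ 1ℚ) M₂≤M+1
      sum≋1 : sum coefficient ≋ 1ℝ
      sum≋1 = termwise λ _ → refl
      x≋ : ∀ e → x e ≋ sum λ r → coefficient r * point r e
      x≋ e = termwise λ m → rearrange (seq (x e) m) M (seq (C e) m)
        where
        rearrange : ∀ a M c → a ≡
          1ℚ ℚ.* (a ℚ.+ M ℚ.* c) ℚ.+ (1ℚ ℚ.* c ℚ.+
            ((ℚ.- 1ℚ) ℚ.* (0ℚ ℚ.+ (M ℚ.+ 1ℚ) ℚ.* c) ℚ.+ 0ℚ))
        rearrange = solve 3 (λ a M c → a :=
          con 1ℚ :* (a :+ M :* c) :+ (con 1ℚ :* c :+
            ((:- con 1ℚ) :* (con 0ℚ :+ (M :+ con 1ℚ) :* c) :+ con 0ℚ))) refl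
          where open +-*-Solver

theorem2p9 : ExcludedMiddle 0ℓ →
    (G : DAG) (C : ℝ^E G) (gen : Generic G C) →
    IsOpenPolyhedralCone G (cone G C) ×
    IsFullDimensional G (cone G C) ×
    cone G C ≐ CriticalInequalities G C gen
theorem2p9 em G C gen =
  cone-isOpenPolyhedral em G C gen ,
  cone-isFullDimensional em G C gen ,
  cone≐inequalities em G C gen
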